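{- Let $G$ be a graph of order $n$. Then (i) $\lambda(G)=n-1$ if and only if $G=K_1$; (ii) $\lambda(G)=n-2$ if and only if $G=P_{n-1}\cup K_1$ or $G=P_3$.
   Context: Graphs are finite, simple (no loops or multiple edges), undirected; $n=|V(G)|$ is the order of $G$ (at least 1). $P_m$ is the path on $m$ vertices, $K_m$ the complete graph on $m$ vertices, and $G\cup H$ is the disjoint union of graphs. Standard zero forcing: a subset $S\subseteq V(G)$ is colored blue and all other vertices white. Standard color change rule: if a blue vertex has exactly one white neighbor, then that white neighbor becomes blue. $S$ is a zero forcing set if repeated application of the rule eventually turns all vertices blue. The zero forcing span $\lambda(G)$ is the number of distinct cardinalities $k$ for which there exist $Z,F\subseteq V(G)$ with $|Z|=|F|=k$ such that $Z$ is a zero forcing set and $F$ is not a zero forcing set.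
   Formalization: Part (ii) is stated for G not equal to K_2, because λ(K_2)=0=n-2 although K_2 is neither P_1∪K_1 nor P_3; the case G=P_{n-1}∪K_1 is read with n at least 2. -}

module Defs where

open import Data.Bool.Properties using () renaming (_≟_ to _≟ᵇ_)
open import Data.Fin using (Fin; toℕ; splitAt)
open import Data.Fin.Properties using (any?; all?) renaming (_≟_ to _≟ᶠ_)
open import Data.Fin.Subset using (Subset; _∈_; _∉_; _⊃_; _∪_; ⁅_⁆; ⊤; ∣_∣)
open import Data.Fin.Subset.Induction using (⊃-wellFounded)
open import Data.Fin.Subset.Properties using (_∈?_; anySubset?; p⊆p∪q; q⊆p∪q; x∈⁅x⁆)
open import Data.List using (length; filter; upTo)
open import Data.Nat using (ℕ; suc; _+_; _≟_)
open import Data.Nat.Properties using (1+n≢n)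
open import Data.Product using (∃; ∃₂; ∃-syntax; _×_; _,_)
open import Data.Sum using (_⊎_; inj₁; inj₂; [_,_]′; swap)
open import Data.Sum.Relation.Binary.Pointwise
  using (Pointwise; ⊎-symmetric; ⊎-decidable)
open import Data.Vec.Properties using (≡-dec)
open import Function using (_∘_; _⇔_; _↔_; Inverse)
open import Induction.WellFounded using (Acc; acc)
open import Level using (0ℓ)
open import Relation.Binary using (Rel; Decidable; Symmetric)
open import Relation.Binary.Construct.Closure.ReflexiveTransitive using (Star; ε; _◅_)
open import Relation.Binary.PropositionalEquality using (_≡_; _≢_; refl; sym)
open import Relation.Nullary using (¬_; Dec; yes; no)
open import Relation.Nullary.Decidable using (map′; ¬?; _×-dec_; _⊎-dec_; _→-dec_)

------------------------------------------------------------------------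
-- Graphs

record Graph (n : ℕ) : Set₁ where
  field
    Adj        : Rel (Fin n) 0ℓ
    adj?       : Decidable Adj
    adj-sym    : Symmetric Adj
    adj-irrefl : ∀ {v} → ¬ Adj v v

open Graph public

infix 4 _≅_

record _≅_ {m n : ℕ} (G : Graph m) (H : Graph n) : Set where
  field
    bijection : Fin m ↔ Fin n
  open Inverse bijection public using (to; from)
  field
    adj-⇔ : ∀ u v → Adj G u v ⇔ Adj H (to u) (to v)

complete : ∀ m → Graph m
complete m = record
  { Adj        = _≢_
  ; adj?       = λ u v → ¬? (u ≟ᶠ v)
  ; adj-sym    = λ u≢v → u≢v ∘ sym
  ; adj-irrefl = λ v≢v → v≢v refl
  }

path : ∀ m → Graph m
path m = record
  { Adj        = λ u v → suc (toℕ u) ≡ toℕ v ⊎ suc (toℕ v) ≡ toℕ u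
  ; adj?       = λ u v → (suc (toℕ u) ≟ toℕ v) ⊎-dec (suc (toℕ v) ≟ toℕ u)
  ; adj-sym    = swap
  ; adj-irrefl = [ 1+n≢n , 1+n≢n ]′
  }

infixr 6 _⊔ᴳ_

_⊔ᴳ_ : ∀ {m n} → Graph m → Graph n → Graph (m + n)
_⊔ᴳ_ {m} G H = record
  { Adj        = λ u v → Pointwise (Adj G) (Adj H) (splitAt m u) (splitAt m v)
  ; adj?       = λ u v → ⊎-decidable (adj? G) (adj? H) (splitAt m u) (splitAt m v)
  ; adj-sym    = ⊎-symmetric (adj-sym G) (adj-sym H)
  ; adj-irrefl = λ {v} → irrefl (splitAt m v)
  }
  where
  irrefl : ∀ x → ¬ Pointwise (Adj G) (Adj H) x x
  irrefl (inj₁ x) (Pointwise.inj₁ p) = adj-irrefl G p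
  irrefl (inj₂ y) (Pointwise.inj₂ p) = adj-irrefl H p

------------------------------------------------------------------------
-- Zero forcing.  The members of a subset are the blue vertices.

module _ {n : ℕ} (G : Graph n) where

  UniqueWhiteNeighbour : Subset n → Fin n → Fin n → Set
  UniqueWhiteNeighbour S u v =
    (Adj G u v × v ∉ S) × (∀ w → Adj G u w × w ∉ S → w ≡ v)

  Forces : Subset n → Fin n → Fin n → Set
  Forces S u v = u ∈ S × UniqueWhiteNeighbour S u v

  -- A single application of the color change rule.
  infix 4 _⟶_
  _⟶_ : Rel (Subset n) 0ℓ
  S ⟶ T = ∃₂ λ u v → Forces S u v × T ≡ S ∪ ⁅ v ⁆

  ZeroForcing : Subset n → Set
  ZeroForcing S = Star _⟶_ S ⊤

  forces? : ∀ S u v → Dec (Forces S u v)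
  forces? S u v =
    (u ∈? S) ×-dec
    ((adj? G u v ×-dec ¬? (v ∈? S)) ×-dec
     all? (λ w → (adj? G u w ×-dec ¬? (w ∈? S)) →-dec (w ≟ᶠ v)))

  private
    forces-grows : ∀ {S u v} → Forces S u v → (S ∪ ⁅ v ⁆) ⊃ S
    forces-grows {S} {v = v} (_ , (_ , v∉S) , _) =
      p⊆p∪q ⁅ v ⁆ , v , q⊆p∪q S ⁅ v ⁆ (x∈⁅x⁆ v) , v∉S

    -- S is zero forcing iff it is already everything or some force out of S
    -- leads to a zero forcing set.
    zeroForcing?-acc : ∀ S → Acc _⊃_ S → Dec (ZeroForcing S)
    zeroForcing?-acc S (acc rs) =
      map′ fold unfold (≡-dec _≟ᵇ_ S ⊤ ⊎-dec any? λ u → any? λ v → next? u v)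
      where
      Next : Fin n → Fin n → Set
      Next u v = Forces S u v × ZeroForcing (S ∪ ⁅ v ⁆)

      next? : ∀ u v → Dec (Next u v)
      next? u v with forces? S u v
      ... | no ¬f = no λ (f , _) → ¬f f
      ... | yes f =
        map′ (f ,_) (λ (_ , z) → z)
             (zeroForcing?-acc (S ∪ ⁅ v ⁆) (rs (forces-grows f)))

      fold : S ≡ ⊤ ⊎ ∃₂ Next → ZeroForcing S
      fold (inj₁ refl)            = ε
      fold (inj₂ (u , v , f , z)) = (u , v , f , refl) ◅ z

      unfold : ZeroForcing S → S ≡ ⊤ ⊎ ∃₂ Next
      unfold ε                        = inj₁ refl
      unfold ((u , v , f , refl) ◅ z) = inj₂ (u , v , f , z)

  zeroForcing? : ∀ S → Dec (ZeroForcing S)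
  zeroForcing? S = zeroForcing?-acc S (⊃-wellFounded S)

  MixedCardinality : ℕ → Set
  MixedCardinality k =
    (∃[ Z ] ∣ Z ∣ ≡ k × ZeroForcing Z) × (∃[ F ] ∣ F ∣ ≡ k × ¬ ZeroForcing F)

  mixedCardinality? : ∀ k → Dec (MixedCardinality k)
  mixedCardinality? k =
    anySubset? (λ Z → (∣ Z ∣ ≟ k) ×-dec zeroForcing? Z) ×-dec
    anySubset? (λ F → (∣ F ∣ ≟ k) ×-dec ¬? (zeroForcing? F))

  -- Every subset has cardinality at most n, so it suffices to count k ≤ n.
  zeroForcingSpan : ℕ
  zeroForcingSpan = length (filter mixedCardinality? (upTo (suc n)))

{-# OPTIONS --safe #-}

-- Only the sizes 1, …, n − 1 can be mixed.  If 1 is mixed, some singleton is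
-- zero forcing; the successive forces then trace out G, so G is a path and has
-- no isolated vertex when n ≥ 2.  If n − 1 is mixed, the vertex missing from a
-- failing set of that size is isolated.  Hence 1 and n − 1 are not both mixed,
-- and for n ≥ 3 span n − 2 leaves two cases.
--   * Only n − 1 is unmixed: G is a path with a failing set missing just two
--     vertices.  Any other vertex is adjacent to both or to neither of these
--     two, which forces n = 3.
--   * Only 1 is unmixed: G has an isolated vertex k and a forcing pair, which
--     must contain k; the other member of the pair forces G − k, a path.
module Submission where

open import Defs
open import Data.Nat using (ℕ; _+_; _∸_; _≤_)
open import Data.Product using (_×_)
open import Data.Sum using (_⊎_)
open import Function using (_⇔_)
open import Relation.Binary.PropositionalEquality using (_≡_)
open import Relation.Nullary using (¬_)

open import Data.Empty using (⊥; ⊥-elim)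
open import Data.Fin using (Fin; zero; suc; toℕ; fromℕ<; splitAt; join; _↑ˡ_; _↑ʳ_)
open import Data.Fin.Patterns using (0F; 1F; 2F)
open import Data.Fin.Permutation using (↔⇒≡)
open import Data.Fin.Properties
  using (injective⇒≤; toℕ-injective; toℕ-fromℕ<; toℕ<n; join-splitAt;
         splitAt-↑ˡ; splitAt-↑ʳ)
  renaming (_≟_ to _≟ᶠ_; suc-injective to Fin-suc-injective)
open import Data.Fin.Subset
  using (Subset; inside; outside; _∈_; _∉_; _⊆_; _∪_; ∁; ⁅_⁆; ⊤; ∣_∣)
  renaming (⊥ to ∅)
open import Data.Fin.Subset.Properties
  using (_∈?_; ∈⊤; ⊆⊤; ⊥⊆; ⊆-antisym; ∣p∣≤n; ∣⊥∣≡0; ∣⊤∣≡n; ∣⁅x⁆∣≡1;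
         ∣p∣≡n⇒p≡⊤; ∣∁p∣≡n∸∣p∣; x∉p⇒x∈∁p; x∈∁p⇒x∉p; x∈⁅x⁆; x∈⁅y⁆⇒x≡y; p⊆p∪q;
         q⊆p∪q; x∈p∪q⁻; drop-∷-⊆; out⊆; in⊆in)
open import Data.List using (List; []; _∷_; _++_; length; lookup; filter; upTo; applyUpTo)
open import Data.List.Membership.Propositional using () renaming (_∈_ to _∈ˡ_)
open import Data.List.Membership.Propositional.Properties
  using (∈-lookup; ∈-filter⁺; ∈-filter⁻; ∈-upTo⁺; ∈-++⁻)
open import Data.List.Properties using (length-++; length-upTo; length-applyUpTo)
open import Data.List.Relation.Unary.All as All using (All; []; _∷_)
open import Data.List.Relation.Unary.All.Properties using () renaming (applyUpTo⁺₁ to All-applyUpTo⁺)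
open import Data.List.Relation.Unary.AllPairs using ([]; _∷_)
open import Data.List.Relation.Unary.Any using (index)
open import Data.List.Relation.Unary.Any.Properties using (lookup-index)
open import Data.List.Relation.Unary.Unique.Propositional using (Unique)
open import Data.List.Relation.Unary.Unique.Propositional.Properties
  using (applyUpTo⁺₁; upTo⁺; filter⁺; ++⁺)
open import Data.Nat using (zero; suc; _<_; z≤n; s≤s; z<s; s<s; s≤s⁻¹; _≤?_; _<?_)
open import Data.Nat.Properties
open import Data.Product using (∃; ∃-syntax; _,_; proj₁; proj₂)
open import Data.Sum using (inj₁; inj₂; [_,_]′)
open import Data.Sum.Relation.Binary.Pointwise using (Pointwise)
open import Data.Vec.Functional using () renaming (_∷_ to _◂_)
open import Data.Vec using ([]; _∷_; here; there)
open import Function using (_∘_; mk⇔; mk↔ₛ′; Equivalence; Inverse; id; const)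
open import Function.Definitions using (Injective)
open import Function.Construct.Identity using (↔-id)
open import Relation.Binary using (tri<; tri≈; tri>)
open import Relation.Binary.Construct.Closure.ReflexiveTransitive using (ε; _◅_)
open import Relation.Binary.PropositionalEquality
  using (_≢_; refl; sym; trans; cong; cong₂; subst; subst₂; ≢-sym)
open import Relation.Nullary using (Dec; yes; no; contradiction)
open import Relation.Nullary.Decidable using (decidable-stable)

-- Counting in lists and in finite subsets.

lookup-injective : ∀ {a} {A : Set a} {xs : List A} → Unique xs → Injective _≡_ _≡_ (lookup xs)
lookup-injective (_ ∷ _)   {zero}  {zero}  _  = refl
lookup-injective (x∉ ∷ _)  {zero}  {suc j} eq = contradiction eq (All.lookup x∉ (∈-lookup j))
lookup-injective (x∉ ∷ _)  {suc i} {zero}  eq = contradiction (sym eq) (All.lookup x∉ (∈-lookup i))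
lookup-injective (_ ∷ xs!) {suc i} {suc j} eq = cong suc (lookup-injective xs! eq)

-- Pigeonhole: sending an index of `xs` to the position of its entry in `ys` is injective, since
-- `lookup ys` recovers the entry.
unique-⊆⇒length≤ : ∀ {a} {A : Set a} {xs ys : List A} → Unique xs →
  (∀ {x} → x ∈ˡ xs → x ∈ˡ ys) → length xs ≤ length ys
unique-⊆⇒length≤ {xs = xs} {ys} xs! xs⊆ys = injective⇒≤ {f = position} position-injective
  where
  position : Fin (length xs) → Fin (length ys)
  position i = index (xs⊆ys (∈-lookup i))

  position-injective : Injective _≡_ _≡_ position
  position-injective {i} {j} eq = lookup-injective xs!
    (trans (lookup-index (xs⊆ys (∈-lookup i)))
      (trans (cong (lookup ys) eq) (sym (lookup-index (xs⊆ys (∈-lookup j))))))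

∣p∪q∣≤∣p∣+∣q∣ : ∀ {n} (p q : Subset n) → ∣ p ∪ q ∣ ≤ ∣ p ∣ + ∣ q ∣
∣p∪q∣≤∣p∣+∣q∣ []            []            = z≤n
∣p∪q∣≤∣p∣+∣q∣ (outside ∷ p) (outside ∷ q) = ∣p∪q∣≤∣p∣+∣q∣ p q
∣p∪q∣≤∣p∣+∣q∣ (outside ∷ p) (inside ∷ q)  =
  ≤-trans (s≤s (∣p∪q∣≤∣p∣+∣q∣ p q)) (≤-reflexive (sym (+-suc ∣ p ∣ ∣ q ∣)))
∣p∪q∣≤∣p∣+∣q∣ (inside ∷ p)  (outside ∷ q) = s≤s (∣p∪q∣≤∣p∣+∣q∣ p q)
∣p∪q∣≤∣p∣+∣q∣ (inside ∷ p)  (inside ∷ q)  =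
  s≤s (≤-trans (∣p∪q∣≤∣p∣+∣q∣ p q) (+-monoʳ-≤ ∣ p ∣ (n≤1+n ∣ q ∣)))

subset-between : ∀ {n} {p q : Subset n} {k} → p ⊆ q → ∣ p ∣ ≤ k → k ≤ ∣ q ∣ →
  ∃[ r ] ∣ r ∣ ≡ k × p ⊆ r × r ⊆ q
subset-between {p = []} {[]} _ _ z≤n = [] , refl , id , id
subset-between {p = outside ∷ p} {outside ∷ q} p⊆q p≤k k≤q
  with r , r≡k , p⊆r , r⊆q ← subset-between (drop-∷-⊆ p⊆q) p≤k k≤q
  = outside ∷ r , r≡k , out⊆ p⊆r , out⊆ r⊆q
subset-between {p = inside ∷ p} {outside ∷ q} p⊆q _ _ with () ← p⊆q here
subset-between {p = inside ∷ p} {inside ∷ q} p⊆q (s≤s p≤k) (s≤s k≤q)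
  with r , r≡k , p⊆r , r⊆q ← subset-between (drop-∷-⊆ p⊆q) p≤k k≤q
  = inside ∷ r , cong suc r≡k , in⊆in p⊆r , in⊆in r⊆q
subset-between {p = outside ∷ p} {inside ∷ q} {k} p⊆q p≤k k≤1+q with k ≤? ∣ q ∣
... | yes k≤q
  with r , r≡k , p⊆r , r⊆q ← subset-between (drop-∷-⊆ p⊆q) p≤k k≤q
  = outside ∷ r , r≡k , out⊆ p⊆r , out⊆ r⊆q
-- The size no longer fits into the tail, so it is exactly that of `inside ∷ q`, which is taken
-- whole.
... | no  k≰q = inside ∷ q , ≤-antisym (≰⇒> k≰q) k≤1+q , out⊆ (drop-∷-⊆ p⊆q) , id

-- Indexing by `Fin k` turns reasoning about sets of size 1 or 2 into case analysis on `0F` and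
-- `1F`.
enumerate : ∀ {n k} (p : Subset n) → ∣ p ∣ ≡ k →
  ∃[ f ] Injective {A = Fin k} {B = Fin n} _≡_ _≡_ f
       × (∀ i → f i ∈ p) × (∀ {x} → x ∈ p → ∃[ i ] x ≡ f i)
enumerate [] refl = (λ ()) , (λ { {()} }) , (λ ()) , λ ()
enumerate (outside ∷ p) refl with f , f-inj , f∈p , f-onto ← enumerate p refl =
  suc ∘ f , f-inj ∘ Fin-suc-injective , there ∘ f∈p ,
  λ { (there x∈p) → let i , x≡fi = f-onto x∈p in i , cong suc x≡fi }
enumerate {n = suc n} (inside ∷ p) refl with f , f-inj , f∈p , f-onto ← enumerate p refl =
  g , g-inj , (λ { zero → here ; (suc i) → there (f∈p i) }) ,
  λ { here → 0F , refl
    ; (there x∈p) → let i , x≡fi = f-onto x∈p in suc i , cong suc x≡fi }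
  where
  g : Fin (suc ∣ p ∣) → Fin (suc n)
  g = 0F ◂ (suc ∘ f)

  g-inj : Injective _≡_ _≡_ g
  g-inj {zero}  {zero}  _  = refl
  g-inj {suc i} {suc j} eq = cong suc (f-inj (Fin-suc-injective eq))

full⇒≡⊤ : ∀ {n} {p : Subset n} → (∀ x → x ∈ p) → p ≡ ⊤
full⇒≡⊤ full = ⊆-antisym ⊆⊤ λ {x} _ → full x

≡⊤⇒forcing : ∀ {n} (G : Graph n) {S} → S ≡ ⊤ → ZeroForcing G S
≡⊤⇒forcing _ refl = ε

covered-complement : ∀ {n k} (p : Subset n) → n ∸ ∣ p ∣ ≡ k →
  ∃[ f ] Injective {A = Fin k} {B = Fin n} _≡_ _≡_ f × (∀ {x} → (∀ i → x ≢ f i) → x ∈ p)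
covered-complement p size
  with f , f-inj , _ , f-onto ← enumerate (∁ p) (trans (∣∁p∣≡n∸∣p∣ p) size) =
  f , f-inj , λ {x} x∉f → decidable-stable (x ∈? p)
    λ x∉p → let i , x≡fi = f-onto (x∉p⇒x∈∁p x∉p) in x∉f i x≡fi

-- Twin positions on a path.

Consecutive : ℕ → ℕ → Set
Consecutive i j = suc i ≡ j ⊎ suc j ≡ i

-- A predecessor of `a` would also be next to `b`, impossible as `a < b`; so `a` is 0. A successor
-- of `b` inside the path would be next to 0; so `b` is last. Position 1 is next to 0, hence to `b`,
-- and `b` is 2.
twins-on-path : ∀ {n a b} → a < b → b < n → 3 ≤ n →
  (∀ {k} → k < n → k ≢ a → k ≢ b → Consecutive k a ⇔ Consecutive k b) → n ≡ 3
twins-on-path {n} {suc a} {b} a<b b<n _ twins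
  with Equivalence.to (twins (<-trans (n<1+n a) (<-trans a<b b<n)) (<⇒≢ (n<1+n a))
         (<⇒≢ (<-trans (n<1+n a) a<b))) (inj₁ refl)
... | inj₁ refl = contradiction a<b (<-irrefl refl)
... | inj₂ refl = contradiction (<-trans (n<1+n _) (<-trans (n<1+n _) a<b)) (<-irrefl refl)
twins-on-path {n} {zero} {suc b} a<b b<n 3≤n twins with suc (suc b) <? n
... | yes b+1<n with Equivalence.from (twins b+1<n (λ ()) (≢-sym (<⇒≢ (n<1+n _)))) (inj₂ refl)
...   | inj₁ ()
...   | inj₂ ()
twins-on-path {n} {zero} {suc b} a<b b<n 3≤n twins | no b+1≮n
  with refl ← ≤-antisym (≮⇒≥ b+1≮n) b<n with b
... | zero = contradiction 3≤n λ { (s≤s (s≤s ())) }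
... | suc b with Equivalence.to (twins {1} (s<s z<s) (λ ()) (λ ())) (inj₂ refl)
...   | inj₁ refl = refl

-- Isomorphisms obtained from enumerations of the vertices.

module _ {n m} {G : Graph n} {H : Graph m} where

  ≅⇒order≡ : G ≅ H → n ≡ m
  ≅⇒order≡ = ↔⇒≡ ∘ _≅_.bijection

  from-adj : (iso : G ≅ H) → ∀ i j → Adj G (_≅_.from iso i) (_≅_.from iso j) ⇔ Adj H i j
  from-adj iso i j = subst₂ (λ i′ j′ → Adj G (from i) (from j) ⇔ Adj H i′ j′)
    (strictlyInverseˡ i) (strictlyInverseˡ j) (adj-⇔ (from i) (from j))
    where
    open _≅_ iso
    open Inverse bijection using (strictlyInverseˡ)

  enumeration⇒≅ : (f : Fin m → Fin n) → Injective _≡_ _≡_ f → (∀ x → ∃[ i ] x ≡ f i) →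
    (∀ i j → Adj G (f i) (f j) ⇔ Adj H i j) → G ≅ H
  enumeration⇒≅ f f-inj f-onto f-adj = record
    { bijection = mk↔ₛ′ g f (λ i → f-inj (sym (f∘g (f i)))) (sym ∘ f∘g)
    ; adj-⇔     = λ u v → subst₂ (λ u′ v′ → Adj G u′ v′ ⇔ Adj H (g u) (g v))
                            (sym (f∘g u)) (sym (f∘g v)) (f-adj (g u) (g v))
    }
    where
    g : Fin n → Fin m
    g = proj₁ ∘ f-onto

    f∘g : ∀ x → x ≡ f (g x)
    f∘g = proj₂ ∘ f-onto

-- Bounds on the span from lists of mixed or unmixed sizes.

module Counting {n} (G : Graph n) where

  private
    λG = zeroForcingSpan G
    Mixed = MixedCardinality G

  mixed⇒≤ : ∀ {k} → Mixed k → k ≤ n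
  mixed⇒≤ ((Z , refl , _) , _) = ∣p∣≤n Z

  span-lower : ∀ ks → Unique ks → All Mixed ks → length ks ≤ λG
  span-lower ks ks! mixed = unique-⊆⇒length≤ ks! λ k∈ks →
    let k-mixed = All.lookup mixed k∈ks in
    ∈-filter⁺ (mixedCardinality? G) (∈-upTo⁺ (s≤s (mixed⇒≤ k-mixed))) k-mixed

  -- The mixed sizes followed by `ks` form a list without repetition inside 0, ..., n.
  span-upper : ∀ ks → Unique ks → All (λ k → k ≤ n × ¬ Mixed k) ks → λG + length ks ≤ suc n
  span-upper ks ks! unmixed = begin
    λG + length ks              ≡⟨ length-++ mixed ⟨
    length (mixed ++ ks)        ≤⟨ unique-⊆⇒length≤ unique bounded ⟩
    length (upTo (suc n))       ≡⟨ length-upTo (suc n) ⟩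
    suc n                       ∎
    where
    open ≤-Reasoning
    mixed = filter (mixedCardinality? G) (upTo (suc n))

    unique : Unique (mixed ++ ks)
    unique = ++⁺ (filter⁺ (mixedCardinality? G) (upTo⁺ (suc n))) ks! λ (k∈mixed , k∈ks) →
      proj₂ (All.lookup unmixed k∈ks)
        (proj₂ (∈-filter⁻ (mixedCardinality? G) {xs = upTo (suc n)} k∈mixed))

    bounded : ∀ {k} → k ∈ˡ mixed ++ ks → k ∈ˡ upTo (suc n)
    bounded k∈ with ∈-++⁻ mixed k∈
    ... | inj₁ k∈mixed = proj₁ (∈-filter⁻ (mixedCardinality? G) k∈mixed)
    ... | inj₂ k∈ks    = ∈-upTo⁺ (s≤s (proj₁ (All.lookup unmixed k∈ks)))

  empty-fails : ∀ {Z} → 1 ≤ n → ∣ Z ∣ ≡ 0 → ¬ ZeroForcing G Z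
  empty-fails {Z} 1≤n Z≡0 ε = contradiction (trans (sym (∣⊤∣≡n n)) Z≡0) (≢-sym (<⇒≢ 1≤n))
  empty-fails {Z} 1≤n Z≡0 ((u , _ , (u∈Z , _) , _) ◅ _) with enumerate Z Z≡0
  ... | _ , _ , _ , f-onto with () ← proj₁ (f-onto u∈Z)

  -- Sizes 0 and n are never mixed: the empty set fails as `1 ≤ n`, and the only set of size n is
  -- `⊤`. So the span is at most n - 1, and each listed interior size lowers this bound by one.
  span-upper-interior : 1 ≤ n → ∀ ks → Unique ks →
    All (λ k → (0 < k × k < n) × ¬ Mixed k) ks → λG + length ks < n
  span-upper-interior 1≤n ks ks! unmixed = s≤s⁻¹ (begin
    suc (suc (λG + length ks))  ≡⟨ cong suc (+-suc λG (length ks)) ⟨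
    suc (λG + suc (length ks))  ≡⟨ +-suc λG (suc (length ks)) ⟨
    λG + length (0 ∷ n ∷ ks)    ≤⟨ span-upper (0 ∷ n ∷ ks)
                                     ((<⇒≢ 1≤n ∷ All.map (<⇒≢ ∘ proj₁ ∘ proj₁) unmixed)
                                     ∷ All.map (≢-sym ∘ <⇒≢ ∘ proj₂ ∘ proj₁) unmixed ∷ ks!)
                                     ((z≤n , λ ((Z , Z≡0 , zf) , _) → empty-fails 1≤n Z≡0 zf)
                                     ∷ (≤-refl , λ (_ , F , F≡n , ¬zf) → ¬zf (n-forces F≡n))
                                     ∷ All.map (λ ((_ , k<n) , ¬m) → <⇒≤ k<n , ¬m) unmixed) ⟩
    suc n                       ∎)
    where
    open ≤-Reasoning
    n-forces : ∀ {F} → ∣ F ∣ ≡ n → ZeroForcing G F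
    n-forces F≡n = ≡⊤⇒forcing G (∣p∣≡n⇒p≡⊤ F≡n)

  span≡n-1⇒mixed : λG + 1 ≡ n → ∀ {k} → 0 < k → k < n → Mixed k
  span≡n-1⇒mixed eq {k} 0<k k<n = decidable-stable (mixedCardinality? G k) λ ¬mixed →
    <-irrefl eq (span-upper-interior (≤-<-trans z≤n k<n) (k ∷ []) ([] ∷ [])
      (((0<k , k<n) , ¬mixed) ∷ []))

  span≡n-2⇒mixed : λG + 2 ≡ n → ∀ {j k} → 0 < j → j < n → 0 < k → k < n → j ≢ k →
    ¬ Mixed j → Mixed k
  span≡n-2⇒mixed eq {j} {k} 0<j j<n 0<k k<n j≢k ¬mixed-j =
    decidable-stable (mixedCardinality? G k) λ ¬mixed-k →
    <-irrefl eq (span-upper-interior (≤-<-trans z≤n k<n) (j ∷ k ∷ []) ((j≢k ∷ []) ∷ [] ∷ [])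
      (((0<j , j<n) , ¬mixed-j) ∷ ((0<k , k<n) , ¬mixed-k) ∷ []))

-- Isolated vertices, and failing sets that miss one or two vertices.

module Forcing {n} (G : Graph n) where

  Isolated : Fin n → Set
  Isolated v = ∀ u → ¬ Adj G u v

  -- A vertex coloured by a force has a neighbour; the claim is pulled back along the chain of
  -- forces from `⊤`.
  isolated⇒initially-blue : ∀ {S k} → Isolated k → ZeroForcing G S → k ∈ S
  isolated⇒initially-blue iso ε = ∈⊤
  isolated⇒initially-blue {S} iso ((u , v , (_ , (uv , _) , _) , refl) ◅ zf)
    with x∈p∪q⁻ S ⁅ v ⁆ (isolated⇒initially-blue iso zf)
  ... | inj₁ k∈S = k∈S
  ... | inj₂ k∈v with refl ← x∈⁅y⁆⇒x≡y v k∈v = contradiction uv (iso u)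

  -- An isolated vertex would be the single blue one, yet the first force comes from that vertex
  -- along an edge. Some force must occur, because `⊤` has two distinct members.
  singleton-forcing⇒no-isolated : ∀ {Z v} → 2 ≤ n → (∀ {x} → x ∈ Z → x ≡ v) →
    ZeroForcing G Z → ∀ k → ¬ Isolated k
  singleton-forcing⇒no-isolated (s≤s (s≤s _)) Z⊆v ε k _
    with () ← trans (Z⊆v (∈⊤ {x = 0F})) (sym (Z⊆v (∈⊤ {x = 1F})))
  singleton-forcing⇒no-isolated _ Z⊆v zf@((u , w , (u∈Z , (uw , _) , _) , _) ◅ _) k iso
    with refl ← trans (Z⊆v u∈Z) (sym (Z⊆v (isolated⇒initially-blue iso zf))) =
    iso w (adj-sym G uw)

  -- A neighbour of `y` is blue and has no white neighbour other than `y`, so it would force `y` and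
  -- complete `F`. If `y` is already in `F`, then `F` is `⊤`.
  missing-one⇒isolated : ∀ {F y} → (∀ {x} → x ≢ y → x ∈ F) → ¬ ZeroForcing G F → Isolated y
  missing-one⇒isolated {F} {y} rest ¬zf u uy with y ∈? F
  ... | yes y∈F = ¬zf (≡⊤⇒forcing G (full⇒≡⊤ full))
    where
    full : ∀ x → x ∈ F
    full x with x ≟ᶠ y
    ... | yes refl = y∈F
    ... | no  x≢y  = rest x≢y
  ... | no  y∉F = ¬zf ((u , y , forces , refl) ◅
                       ≡⊤⇒forcing G (full⇒≡⊤ full))
    where
    forces : Forces G F u y
    forces = rest (λ { refl → adj-irrefl G uy }) , (uy , y∉F) ,
      λ w (_ , w∉F) → decidable-stable (w ≟ᶠ y) (w∉F ∘ rest)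

    full : ∀ x → x ∈ F ∪ ⁅ y ⁆
    full x with x ≟ᶠ y
    ... | yes refl = q⊆p∪q F ⁅ y ⁆ (x∈⁅x⁆ y)
    ... | no  x≢y  = p⊆p∪q ⁅ y ⁆ (rest x≢y)

  -- If `u` saw `x` but not `y`, it would force `x` whenever `x` is white. Then at most `y` is left
  -- white, and failure would make `y` isolated.
  missing-two⇒twins : (∀ k → ¬ Isolated k) → ∀ {F x y} → (∀ {w} → w ≢ x → w ≢ y → w ∈ F) →
    ¬ ZeroForcing G F → ∀ u → u ≢ x → u ≢ y → Adj G u x → Adj G u y
  missing-two⇒twins no-iso {F} {x} {y} rest ¬zf u u≢x u≢y ux =
    decidable-stable (adj? G u y) absurd
    where
    absurd : ¬ ¬ Adj G u y
    absurd ¬uy with x ∈? F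
    ... | yes x∈F = no-iso y (missing-one⇒isolated rest′ ¬zf)
      where
      rest′ : ∀ {w} → w ≢ y → w ∈ F
      rest′ {w} w≢y with w ≟ᶠ x
      ... | yes refl = x∈F
      ... | no  w≢x  = rest w≢x w≢y
    ... | no  x∉F = no-iso y (missing-one⇒isolated rest′ (λ zf → ¬zf ((u , x , forces , refl) ◅ zf)))
      where
      forces : Forces G F u x
      forces = rest u≢x u≢y , (ux , x∉F) , λ w (uw , w∉F) →
        decidable-stable (w ≟ᶠ x) λ w≢x → w∉F (rest w≢x λ { refl → ¬uy uw })

      rest′ : ∀ {w} → w ≢ y → w ∈ F ∪ ⁅ x ⁆
      rest′ {w} w≢y with w ≟ᶠ x
      ... | yes refl = q⊆p∪q F ⁅ x ⁆ (x∈⁅x⁆ x)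
      ... | no  w≢x  = p⊆p∪q ⁅ x ⁆ (rest w≢x w≢y)

  -- Induced paths traced out by forces.

  -- An induced path f in G which, together with the isolated vertices in B,
  -- covers S.
  record Spine (B : Fin n → Set) (S : Subset n) (m : ℕ) : Set where
    field
      f          : Fin m → Fin n
      f-inj      : Injective _≡_ _≡_ f
      f-adj      : ∀ i j → Adj G (f i) (f j) ⇔ Adj (path m) i j
      B-isolated : ∀ {x} → B x → Isolated x
      covers     : ∀ {x} → x ∈ S → B x ⊎ ∃[ i ] x ≡ f i

  module _ {B : Fin n → Set} where

    -- In a chain of forces started from a single non-isolated vertex only the
    -- vertex coloured last, kept as f 0F, may have white neighbours.
    grow : ∀ {S m} (P : Spine B S (suc m)) →
      (∀ i → Spine.f P i ∈ S) → (∀ i → ¬ B (Spine.f P i)) →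
      (∀ i {w} → Adj G (Spine.f P (suc i)) w → w ∈ S) →
      ZeroForcing G S → ∃[ l ] ∃[ Q ] ∀ i → ¬ B (Spine.f {B} {⊤} {l} Q i)
    grow P _ f∉B _ ε = _ , P , f∉B
    grow {S} {m} P f∈S f∉B saturated ((u , w , (u∈S , (uw , w∉S) , only-w) , refl) ◅ zf)
      with Spine.covers P u∈S
    -- Isolated vertices force nothing and each `f (suc i)` has no white neighbour, so the force
    -- comes from the end `f 0F`, and `w` is put in front of it.
    ... | inj₁ Bu = contradiction (adj-sym G uw) (Spine.B-isolated P Bu w)
    ... | inj₂ (suc i , refl) = contradiction (saturated i uw) w∉S
    ... | inj₂ (zero , refl) = grow Q g∈S g∉B g-saturated zf
      where
      open Spine P

      g : Fin (suc (suc m)) → Fin n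
      g = w ◂ f

      g-inj : Injective _≡_ _≡_ g
      g-inj {zero}  {zero}  _  = refl
      g-inj {zero}  {suc j} eq = contradiction (subst (_∈ S) (sym eq) (f∈S j)) w∉S
      g-inj {suc i} {zero}  eq = contradiction (subst (_∈ S) eq (f∈S i)) w∉S
      g-inj {suc i} {suc j} eq = cong suc (f-inj eq)

      g-adj : ∀ i j → Adj G (g i) (g j) ⇔ Adj (path (suc (suc m))) i j
      g-adj zero zero = mk⇔ (⊥-elim ∘ adj-irrefl G) [ (λ ()) , (λ ()) ]′
      g-adj zero (suc zero) = mk⇔ (const (inj₁ refl)) (const (adj-sym G uw))
      -- An edge from `w` to a saturated vertex would make `w` blue already; this keeps the path
      -- induced.
      g-adj zero (suc (suc j)) =
        mk⇔ (λ wf → contradiction (saturated j (adj-sym G wf)) w∉S) [ (λ ()) , (λ ()) ]′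
      g-adj (suc zero) zero = mk⇔ (const (inj₂ refl)) (const uw)
      g-adj (suc (suc i)) zero =
        mk⇔ (λ fw → contradiction (saturated i fw) w∉S) [ (λ ()) , (λ ()) ]′
      g-adj (suc i) (suc j) = mk⇔
        ([ inj₁ ∘ cong suc , inj₂ ∘ cong suc ]′ ∘ Equivalence.to (f-adj i j))
        (Equivalence.from (f-adj i j) ∘ [ inj₁ ∘ suc-injective , inj₂ ∘ suc-injective ]′)

      Q : Spine B (S ∪ ⁅ w ⁆) (suc (suc m))
      Q = record
        { f = g ; f-inj = g-inj ; f-adj = g-adj ; B-isolated = B-isolated
        ; covers = λ x∈ → [ [ inj₁ , (λ (i , eq) → inj₂ (suc i , eq)) ]′ ∘ covers
                          , (λ x∈w → inj₂ (zero , x∈⁅y⁆⇒x≡y w x∈w)) ]′ (x∈p∪q⁻ S ⁅ w ⁆ x∈)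
        }

      g∈S : ∀ i → g i ∈ S ∪ ⁅ w ⁆
      g∈S zero    = q⊆p∪q S ⁅ w ⁆ (x∈⁅x⁆ w)
      g∈S (suc i) = p⊆p∪q ⁅ w ⁆ (f∈S i)

      g∉B : ∀ i → ¬ B (g i)
      g∉B zero    Bw = B-isolated Bw (f zero) uw
      g∉B (suc i) Bf = f∉B i Bf

      g-saturated : ∀ i {x} → Adj G (f i) x → x ∈ S ∪ ⁅ w ⁆
      g-saturated (suc i) fx = p⊆p∪q ⁅ w ⁆ (saturated i fx)
      -- The old end becomes saturated: its only white neighbour was `w`.
      g-saturated zero {x} ux with x ∈? S
      ... | yes x∈S = p⊆p∪q ⁅ w ⁆ x∈S
      ... | no  x∉S with refl ← only-w x (ux , x∉S) = q⊆p∪q S ⁅ w ⁆ (x∈⁅x⁆ w)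

    -- Used with `B` empty for a forcing singleton, and with `B` holding of just the isolated vertex
    -- for a forcing pair. The chain ends at `⊤`, so the spine and `B` exhaust the graph.
    chain : ∀ {S v} → (∀ {x} → B x → Isolated x) → v ∈ S → ¬ B v →
      (∀ {x} → x ∈ S → B x ⊎ x ≡ v) → ZeroForcing G S →
      ∃[ m ] ∃[ P ] ∀ i → ¬ B (Spine.f {B} {⊤} {m} P i)
    chain {S} {v} B-isolated v∈S ¬Bv S⊆ = grow {m = 0} start (λ _ → v∈S) (λ _ → ¬Bv) (λ ())
      where
      start : Spine B S 1
      start = record
        { f          = const v
        ; f-inj      = λ { {zero} {zero} _ → refl }
        ; f-adj      = λ { zero zero → mk⇔ (⊥-elim ∘ adj-irrefl G) [ (λ ()) , (λ ()) ]′ }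
        ; B-isolated = B-isolated
        ; covers     = [ inj₁ , (λ x≡v → inj₂ (zero , x≡v)) ]′ ∘ S⊆
        }

    module _ {m} (P : Spine B ⊤ m) where

      open Spine P

      -- The vertices f 0F, f 1F, … turn blue in this order; those up to
      -- f j are already blue and d are still to be examined.
      sweep : ∀ d j {S} → d + suc j ≡ m → (∀ {x} → B x → x ∈ S) →
        (∀ i → toℕ i ≤ j → f i ∈ S) → ZeroForcing G S
      sweep zero j {S} refl B⊆S blue = ≡⊤⇒forcing G (full⇒≡⊤ full)
        where
        full : ∀ x → x ∈ S
        full x with covers (∈⊤ {x = x})
        ... | inj₁ Bx         = B⊆S Bx
        ... | inj₂ (i , refl) = blue i (s≤s⁻¹ (toℕ<n i))
      sweep (suc d) j {S} eq B⊆S blue = next (f i₊ ∈? S)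
        where
        j+1<m : suc j < m
        j+1<m = ≤-trans (s≤s (m≤n+m (suc j) d)) (≤-reflexive eq)

        j<m : j < m
        j<m = <-trans (n<1+n j) j+1<m

        i i₊ : Fin m
        i  = fromℕ< j<m
        i₊ = fromℕ< j+1<m

        eq′ : d + suc (suc j) ≡ m
        eq′ = trans (+-suc d (suc j)) eq

        extend : ∀ {T} → S ⊆ T → f i₊ ∈ T → ∀ l → toℕ l ≤ suc j → f l ∈ T
        extend S⊆T fi₊∈T l l≤j+1 with m≤n⇒m<n∨m≡n l≤j+1
        ... | inj₁ l<j+1 = S⊆T (blue l (s≤s⁻¹ l<j+1))
        ... | inj₂ l≡j+1
          with refl ← toℕ-injective (trans l≡j+1 (sym (toℕ-fromℕ< j+1<m))) = fi₊∈T

        next : Dec (f i₊ ∈ S) → ZeroForcing G S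
        -- `S` may contain vertices beyond `f j`; a successor that is already blue is passed over
        -- without a force.
        next (yes fi₊∈S) = sweep d (suc j) eq′ B⊆S (extend id fi₊∈S)
        next (no  fi₊∉S) = (f i , f i₊ , forces , refl) ◅
          sweep d (suc j) eq′ (p⊆p∪q ⁅ f i₊ ⁆ ∘ B⊆S)
            (extend (p⊆p∪q ⁅ f i₊ ⁆) (q⊆p∪q S ⁅ f i₊ ⁆ (x∈⁅x⁆ (f i₊))))
          where
          -- A neighbour of `f i` is its successor on the path or its predecessor, and the
          -- predecessor is blue.
          only : ∀ w → Adj G (f i) w × w ∉ S → w ≡ f i₊
          only w (fw , w∉S) with covers (∈⊤ {x = w})
          ... | inj₁ Bw = contradiction (B⊆S Bw) w∉S
          ... | inj₂ (l , refl) with Equivalence.to (f-adj i l) fw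
          ...   | inj₁ i+1≡l = cong f (toℕ-injective (trans (sym i+1≡l)
                    (trans (cong suc (toℕ-fromℕ< j<m)) (sym (toℕ-fromℕ< j+1<m)))))
          ...   | inj₂ l+1≡i = contradiction (blue l (≤-trans (n≤1+n _)
                    (≤-reflexive (trans l+1≡i (toℕ-fromℕ< j<m))))) w∉S

          forces : Forces G S (f i) (f i₊)
          forces = blue i (≤-reflexive (toℕ-fromℕ< j<m)) ,
            (Equivalence.from (f-adj i i₊) (inj₁ (trans (cong suc (toℕ-fromℕ< j<m))
              (sym (toℕ-fromℕ< j+1<m)))) , fi₊∉S) , only

    -- Allowing any `S` that contains the end and `B` yields forcing sets of every larger size as
    -- well.
    spine-end-forces : ∀ {m S} (P : Spine B ⊤ (suc m)) → (∀ {x} → B x → x ∈ S) →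
      Spine.f P 0F ∈ S → ZeroForcing G S
    spine-end-forces {m} P B⊆S f0∈S =
      sweep P m 0 (+-comm m 1) B⊆S λ { zero _ → f0∈S }

-- Spines as `path m` and as `path m ⊔ᴳ complete 1`.

module _ {n} {G : Graph n} where

  open Forcing G
  open Counting G

  ≅path⇒spine : ∀ {m} → G ≅ path m → Spine (const ⊥) ⊤ m
  ≅path⇒spine {m} iso = record
    { f = from ; f-inj = from-inj ; f-adj = from-adj iso ; B-isolated = λ ()
    ; covers = λ {x} _ → inj₂ (to x , sym (strictlyInverseʳ x))
    }
    where
    open _≅_ iso
    open Inverse bijection using (strictlyInverseʳ; strictlyInverseˡ)
    from-inj : Injective _≡_ _≡_ from
    from-inj {i} {j} eq =
      trans (sym (strictlyInverseˡ i)) (trans (cong to eq) (strictlyInverseˡ j))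

  spine⇒≅path : ∀ {m} → Spine (const ⊥) ⊤ m → G ≅ path m
  spine⇒≅path P = enumeration⇒≅ f f-inj (λ x → [ ⊥-elim , id ]′ (covers (∈⊤ {x = x}))) f-adj
    where open Spine P

  ≅path⊔K₁⇒spine : ∀ {m} → G ≅ path m ⊔ᴳ complete 1 →
    ∃[ k ] ∃[ P ] ∀ i → Spine.f {_≡ k} {⊤} {m} P i ≢ k
  ≅path⊔K₁⇒spine {m} iso = k , record
    { f = f ; f-inj = f-inj ; f-adj = f-adj
    ; B-isolated = λ { refl u uk → k-isolated u uk }
    ; covers = λ {x} _ → covers x } , f≢k
    where
    open _≅_ iso
    open Inverse bijection using (strictlyInverseʳ; strictlyInverseˡ)

    k : Fin n
    k = from (m ↑ʳ 0F)

    f : Fin m → Fin n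
    f i = from (i ↑ˡ 1)

    split-f : ∀ i → splitAt m (to (f i)) ≡ inj₁ i
    split-f i = trans (cong (splitAt m) (strictlyInverseˡ (i ↑ˡ 1))) (splitAt-↑ˡ m i 1)

    split-k : splitAt m (to k) ≡ inj₂ 0F
    split-k = trans (cong (splitAt m) (strictlyInverseˡ (m ↑ʳ 0F))) (splitAt-↑ʳ m 1 0F)

    f≢k : ∀ i → f i ≢ k
    f≢k i eq with () ← trans (sym (split-f i)) (trans (cong (splitAt m ∘ to) eq) split-k)

    f-inj : Injective _≡_ _≡_ f
    f-inj {i} {j} eq
      with refl ← trans (sym (split-f i)) (trans (cong (splitAt m ∘ to) eq) (split-f j)) = refl

    f-adj : ∀ i j → Adj G (f i) (f j) ⇔ Adj (path m) i j
    f-adj i j = mk⇔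
      (λ a → case₁ (subst₂ (Pointwise _ _) (split-f i) (split-f j) (Equivalence.to e a)))
      (λ p → Equivalence.from e (subst₂ (Pointwise _ _) (sym (split-f i)) (sym (split-f j))
                                   (Pointwise.inj₁ p)))
      where
      e = adj-⇔ (f i) (f j)
      case₁ : Pointwise (Adj (path m)) (Adj (complete 1)) (inj₁ i) (inj₁ j) → Adj (path m) i j
      case₁ (Pointwise.inj₁ p) = p

    k-isolated : Isolated k
    k-isolated u uk = absurd (subst (Pointwise _ _ _) split-k (Equivalence.to (adj-⇔ u k) uk))
      where
      absurd : ∀ {x} → ¬ Pointwise (Adj (path m)) (Adj (complete 1)) x (inj₂ 0F)
      absurd (Pointwise.inj₂ {zero} 0≢0) = 0≢0 refl

    covers : ∀ x → x ≡ k ⊎ ∃[ i ] x ≡ f i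
    covers x with splitAt m (to x) | join-splitAt m 1 (to x)
    ... | inj₁ i  | eq = inj₂ (i , trans (sym (strictlyInverseʳ x)) (cong from (sym eq)))
    ... | inj₂ 0F | eq = inj₁ (trans (sym (strictlyInverseʳ x)) (cong from (sym eq)))

  -- Isolation of `k` excludes cross edges, and `f≢k` keeps the two parts disjoint. The map `h`
  -- lives on the sum type, so that adjacency is compared with `Pointwise` by cases.
  spine⇒≅path⊔K₁ : ∀ {m k} (P : Spine (_≡ k) ⊤ m) → (∀ i → Spine.f P i ≢ k) →
    G ≅ path m ⊔ᴳ complete 1
  spine⇒≅path⊔K₁ {m} {k} P f≢k = enumeration⇒≅ (h ∘ splitAt m)
    (λ {i} {j} eq → trans (sym (join-splitAt m 1 i))
                     (trans (cong (join m 1) (h-inj {splitAt m i} {splitAt m j} eq)) (join-splitAt m 1 j)))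
    (λ x → onto (covers (∈⊤ {x = x})))
    (λ i j → h-adj (splitAt m i) (splitAt m j))
    where
    open Spine P

    h : Fin m ⊎ Fin 1 → Fin n
    h = [ f , const k ]′

    h-inj : Injective _≡_ _≡_ h
    h-inj {inj₁ i}  {inj₁ j}  eq = cong inj₁ (f-inj eq)
    h-inj {inj₁ i}  {inj₂ _}  eq = contradiction eq (f≢k i)
    h-inj {inj₂ _}  {inj₁ j}  eq = contradiction (sym eq) (f≢k j)
    h-inj {inj₂ 0F} {inj₂ 0F} eq = refl

    onto : ∀ {x} → x ≡ k ⊎ ∃[ i ] x ≡ f i → ∃[ i ] x ≡ h (splitAt m i)
    onto (inj₁ refl)       = m ↑ʳ 0F , sym (cong h (splitAt-↑ʳ m 1 0F))
    onto (inj₂ (i , refl)) = i ↑ˡ 1 , sym (cong h (splitAt-↑ˡ m i 1))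

    h-adj : ∀ x y → Adj G (h x) (h y) ⇔ Pointwise (Adj (path m)) (Adj (complete 1)) x y
    h-adj (inj₁ i) (inj₁ j) = mk⇔ (Pointwise.inj₁ ∘ Equivalence.to (f-adj i j))
      λ { (Pointwise.inj₁ p) → Equivalence.from (f-adj i j) p }
    h-adj (inj₁ i) (inj₂ _) = mk⇔ (⊥-elim ∘ B-isolated refl (f i)) λ ()
    h-adj (inj₂ _) (inj₁ j) = mk⇔ (⊥-elim ∘ B-isolated refl (f j) ∘ adj-sym G) λ ()
    h-adj (inj₂ 0F) (inj₂ 0F) = mk⇔ (⊥-elim ∘ adj-irrefl G)
      λ { (Pointwise.inj₂ 0≢0) → contradiction refl 0≢0 }

  -- Structure imposed by small forcing sets and by large failing sets.

  forcing-singleton⇒path : ∀ {Z} → ∣ Z ∣ ≡ 1 → ZeroForcing G Z → G ≅ path n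
  forcing-singleton⇒path {Z} Z≡1 zf =
    let f , _ , f∈Z , f-onto = enumerate Z Z≡1
        _ , P , _ = chain {B = const ⊥} (λ ()) (f∈Z 0F) id
                      (λ x∈Z → let i , x≡fi = f-onto x∈Z in inj₂ (trans x≡fi (f-const f i))) zf
        iso = spine⇒≅path P
    -- The chain gives a path of unspecified order; the isomorphism shows this order to be `n`.
    in subst (λ m → G ≅ path m) (sym (≅⇒order≡ iso)) iso
    where
    f-const : (f : Fin 1 → Fin n) → ∀ i → f i ≡ f 0F
    f-const _ 0F = refl

  isolated∧forcing-pair⇒path⊔K₁ : ∀ {k Z} → Isolated k → ∣ Z ∣ ≡ 2 → ZeroForcing G Z →
    G ≅ path (n ∸ 1) ⊔ᴳ complete 1
  isolated∧forcing-pair⇒path⊔K₁ {k} {Z} k-isolated Z≡2 zf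
    with f , f-inj , f∈Z , f-onto ← enumerate Z Z≡2 =
    from-index (f-onto (isolated⇒initially-blue k-isolated zf))
    where
    from-partner : ∀ {v} → v ∈ Z → v ≢ k → (∀ {x} → x ∈ Z → x ≡ k ⊎ x ≡ v) →
      G ≅ path (n ∸ 1) ⊔ᴳ complete 1
    from-partner v∈Z v≢k Z⊆ with m , P , f≢k ← chain {B = _≡ k} (λ { refl → k-isolated }) v∈Z v≢k Z⊆ zf =
      -- The union has `m + 1` vertices, hence `m` is `n ∸ 1`.
      subst (λ l → G ≅ path l ⊔ᴳ complete 1)
        (trans (sym (m+n∸n≡m m 1)) (cong (_∸ 1) (sym (≅⇒order≡ iso)))) iso
      where iso = spine⇒≅path⊔K₁ P f≢k

    from-index : ∃[ i ] k ≡ f i → G ≅ path (n ∸ 1) ⊔ᴳ complete 1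
    from-index (0F , refl) = from-partner (f∈Z 1F) (λ eq → contradiction (f-inj eq) λ ())
      λ x∈Z → case (f-onto x∈Z)
      where
      case : ∀ {x} → ∃[ i ] x ≡ f i → x ≡ f 0F ⊎ x ≡ f 1F
      case (0F , eq) = inj₁ eq
      case (1F , eq) = inj₂ eq
    from-index (1F , refl) = from-partner (f∈Z 0F) (λ eq → contradiction (f-inj eq) λ ())
      λ x∈Z → case (f-onto x∈Z)
      where
      case : ∀ {x} → ∃[ i ] x ≡ f i → x ≡ f 1F ⊎ x ≡ f 0F
      case (0F , eq) = inj₂ eq
      case (1F , eq) = inj₁ eq

  forcing-singleton⇒no-isolated : ∀ {Z} → 2 ≤ n → ∣ Z ∣ ≡ 1 → ZeroForcing G Z → ∀ k → ¬ Isolated k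
  forcing-singleton⇒no-isolated {Z} 2≤n Z≡1 zf
    with f , _ , _ , f-onto ← enumerate Z Z≡1 =
    singleton-forcing⇒no-isolated 2≤n (only ∘ f-onto) zf
    where
    only : ∀ {x} → ∃[ i ] x ≡ f i → x ≡ f 0F
    only (0F , eq) = eq

  failing-cosingleton⇒isolated : ∀ {F} → n ∸ ∣ F ∣ ≡ 1 → ¬ ZeroForcing G F → ∃ Isolated
  failing-cosingleton⇒isolated {F} size ¬zf with f , _ , rest ← covered-complement F size =
    f 0F , missing-one⇒isolated (λ x≢ → rest λ { 0F → x≢ }) ¬zf

  -- By `missing-two⇒twins` in both directions, the two missing vertices have the same neighbours
  -- among the others. Their positions under `iso` then fall under `twins-on-path`, after a swap if
  -- necessary.
  path∧failing-copair⇒order≡3 : ∀ {F} → 3 ≤ n → G ≅ path n → (∀ k → ¬ Isolated k) →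
    n ∸ ∣ F ∣ ≡ 2 → ¬ ZeroForcing G F → n ≡ 3
  path∧failing-copair⇒order≡3 {F} 3≤n iso no-iso size ¬zf
    with f , f-inj , rest ← covered-complement F size =
    by-order (<-cmp (toℕ (to (f 0F))) (toℕ (to (f 1F))))
    where
    open _≅_ iso
    open Inverse bijection using (strictlyInverseʳ; strictlyInverseˡ)

    to-inj : Injective _≡_ _≡_ to
    to-inj {x} {y} eq = trans (sym (strictlyInverseʳ x)) (trans (cong from eq) (strictlyInverseʳ y))

    white-pair : ∀ {x y} → toℕ (to x) < toℕ (to y) → (∀ {w} → w ≢ x → w ≢ y → w ∈ F) → n ≡ 3
    white-pair {x} {y} x<y rest = twins-on-path x<y (toℕ<n (to y)) 3≤n twins
      where
      twins : ∀ {k} → k < n → k ≢ toℕ (to x) → k ≢ toℕ (to y) →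
        Consecutive k (toℕ (to x)) ⇔ Consecutive k (toℕ (to y))
      twins {k} k<n k≢x k≢y = mk⇔
        (adj⇒ y ∘ missing-two⇒twins no-iso rest ¬zf u (u≢ k≢x) (u≢ k≢y) ∘ ⇒adj x)
        (adj⇒ x ∘ missing-two⇒twins no-iso (λ w≢y w≢x → rest w≢x w≢y) ¬zf u (u≢ k≢y) (u≢ k≢x)
          ∘ ⇒adj y)
        where
        u : Fin n
        u = from (fromℕ< k<n)

        toℕ-u : toℕ (to u) ≡ k
        toℕ-u = trans (cong toℕ (strictlyInverseˡ (fromℕ< k<n))) (toℕ-fromℕ< k<n)

        u≢ : ∀ {z} → k ≢ toℕ (to z) → u ≢ z
        u≢ k≢z refl = k≢z (sym toℕ-u)

        adj⇒ : ∀ z → Adj G u z → Consecutive k (toℕ (to z))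
        adj⇒ z uz = subst (λ l → Consecutive l (toℕ (to z))) toℕ-u (Equivalence.to (adj-⇔ u z) uz)

        ⇒adj : ∀ z → Consecutive k (toℕ (to z)) → Adj G u z
        ⇒adj z = Equivalence.from (adj-⇔ u z) ∘ subst (λ l → Consecutive l (toℕ (to z))) (sym toℕ-u)

    rest₀₁ : ∀ {w} → w ≢ f 0F → w ≢ f 1F → w ∈ F
    rest₀₁ ≢0 ≢1 = rest λ { 0F → ≢0 ; 1F → ≢1 }

    by-order : _ → n ≡ 3
    by-order (tri< lt _ _) = white-pair lt rest₀₁
    by-order (tri≈ _ eq _) with () ← f-inj (to-inj (toℕ-injective eq))
    by-order (tri> _ _ gt) = white-pair gt λ ≢1 ≢0 → rest₀₁ ≢0 ≢1

-- Graphs of order one and two.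

≅-byAdjacency : ∀ {n} {G H : Graph n} → (∀ u v → Adj G u v ⇔ Adj H u v) → G ≅ H
≅-byAdjacency adj = record { bijection = ↔-id _ ; adj-⇔ = adj }

one-vertex⇒complete : (G : Graph 1) → G ≅ complete 1
one-vertex⇒complete G = ≅-byAdjacency λ { 0F 0F →
  mk⇔ (⊥-elim ∘ adj-irrefl G) (contradiction refl) }

order2∧≇K₂⇒isolated : (G : Graph 2) → ¬ (G ≅ complete 2) → ∀ u → ¬ Adj G u 1F
order2∧≇K₂⇒isolated G ≇K₂ 1F loop = adj-irrefl G loop
order2∧≇K₂⇒isolated G ≇K₂ 0F edge = ≇K₂ (≅-byAdjacency λ
  { 0F 0F → mk⇔ (⊥-elim ∘ adj-irrefl G) (contradiction refl)
  ; 0F 1F → mk⇔ (const λ ()) (const edge)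
  ; 1F 0F → mk⇔ (const λ ()) (const (adj-sym G edge))
  ; 1F 1F → mk⇔ (⊥-elim ∘ adj-irrefl G) (contradiction refl) })

one-vertex⇒K₁ : ∀ {n} (G : Graph n) → n ≡ 1 → G ≅ complete 1
one-vertex⇒K₁ G refl = one-vertex⇒complete G

-- Order 2 is treated apart because sizes 1 and n - 1 coincide there. Vertex `1F` is isolated, and
-- `⊤` itself serves as the forcing pair.
order2∧≇K₂⇒K₁⊔K₁ : ∀ {n} (G : Graph n) → 2 ≡ n → ¬ (G ≅ complete 2) →
  G ≅ path (n ∸ 1) ⊔ᴳ complete 1
order2∧≇K₂⇒K₁⊔K₁ G refl ≇K₂ =
  isolated∧forcing-pair⇒path⊔K₁ (order2∧≇K₂⇒isolated G ≇K₂) (∣⊤∣≡n 2) ε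

-- Consequences of sizes 1, 2, n - 2 and n - 1 being mixed.

module _ {n} (G : Graph n) where

  open Forcing G

  mixed[n-1]⇒isolated : 1 ≤ n → MixedCardinality G (n ∸ 1) → ∃ Isolated
  mixed[n-1]⇒isolated 1≤n (_ , F , F≡ , ¬zf) =
    failing-cosingleton⇒isolated {G = G} {F} (trans (cong (n ∸_) F≡) (m∸[m∸n]≡n 1≤n)) ¬zf

  mixed[1]⇒unmixed[n-1] : 2 ≤ n → MixedCardinality G 1 → ¬ MixedCardinality G (n ∸ 1)
  mixed[1]⇒unmixed[n-1] 2≤n ((_ , Z≡1 , zf) , _) mixed =
    let k , k-isolated = mixed[n-1]⇒isolated (<⇒≤ 2≤n) mixed
    in forcing-singleton⇒no-isolated {G = G} 2≤n Z≡1 zf k k-isolated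

  mixed[2]∧mixed[n-1]⇒path⊔K₁ : 1 ≤ n → MixedCardinality G 2 → MixedCardinality G (n ∸ 1) →
    G ≅ path (n ∸ 1) ⊔ᴳ complete 1
  mixed[2]∧mixed[n-1]⇒path⊔K₁ 1≤n ((_ , Z≡2 , zf) , _) mixed =
    isolated∧forcing-pair⇒path⊔K₁ (proj₂ (mixed[n-1]⇒isolated 1≤n mixed)) Z≡2 zf

  mixed[1]∧mixed[n-2]⇒P₃ : 3 ≤ n → MixedCardinality G 1 → MixedCardinality G (n ∸ 2) →
    G ≅ path 3
  mixed[1]∧mixed[n-2]⇒P₃ 3≤n ((_ , Z≡1 , Z-forces) , _) (_ , F , F≡ , ¬zf) =
    subst (λ m → G ≅ path m)
      (path∧failing-copair⇒order≡3 {G = G} {F} 3≤n iso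
        (forcing-singleton⇒no-isolated {G = G} (<⇒≤ 3≤n) Z≡1 Z-forces)
        (trans (cong (n ∸_) F≡) (m∸[m∸n]≡n (<⇒≤ 3≤n))) ¬zf)
      iso
    where iso = forcing-singleton⇒path Z≡1 Z-forces

-- Mixed sizes of the extremal graphs.

pair-size : ∀ {n} (v k : Fin n) → ∣ ⁅ v ⁆ ∪ ⁅ k ⁆ ∣ ≤ 2
pair-size v k = ≤-trans (∣p∪q∣≤∣p∣+∣q∣ ⁅ v ⁆ ⁅ k ⁆)
  (≤-reflexive (cong₂ _+_ (∣⁅x⁆∣≡1 v) (∣⁅x⁆∣≡1 k)))

path⊔K₁⇒unmixed[1] : ∀ {n} (G : Graph n) → 2 ≤ n → G ≅ path (n ∸ 1) ⊔ᴳ complete 1 →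
  ¬ MixedCardinality G 1
path⊔K₁⇒unmixed[1] G 2≤n iso ((_ , Z≡1 , zf) , _) =
  let k , P , _ = ≅path⊔K₁⇒spine iso
  in forcing-singleton⇒no-isolated {G = G} 2≤n Z≡1 zf k (Forcing.Spine.B-isolated P refl)

-- Every set containing `k` and an end of the path is forcing; every set avoiding `k` fails, as `k`
-- can never be forced. Between them these cover the sizes 2, ..., n - 1.
path⊔K₁⇒mixed : ∀ {n} (G : Graph n) → G ≅ path (n ∸ 1) ⊔ᴳ complete 1 →
  ∀ {i} → i < n ∸ 2 → MixedCardinality G (2 + i)
-- The bound on `i` gives n at least 2, so the path is nonempty and has the end `0F`.
path⊔K₁⇒mixed {suc (suc l)} G iso {i} i<l with k , P , _ ← ≅path⊔K₁⇒spine iso =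
  forcing , failing
  where
  open Forcing G
  n = suc (suc l)

  forcing : ∃[ Z ] ∣ Z ∣ ≡ 2 + i × ZeroForcing G Z
  forcing with Z , Z≡ , pair⊆Z , _ ←
    subset-between {q = ⊤} {k = 2 + i} ⊆⊤
      (≤-trans (pair-size (Spine.f P 0F) k) (m≤m+n 2 i))
      (≤-trans (s≤s (s≤s (<⇒≤ i<l))) (≤-reflexive (sym (∣⊤∣≡n n)))) =
    Z , Z≡ , spine-end-forces P
      (λ { refl → pair⊆Z (q⊆p∪q ⁅ Spine.f P 0F ⁆ ⁅ k ⁆ (x∈⁅x⁆ k)) })
      (pair⊆Z (p⊆p∪q ⁅ k ⁆ (x∈⁅x⁆ (Spine.f P 0F))))

  failing : ∃[ F ] ∣ F ∣ ≡ 2 + i × ¬ ZeroForcing G F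
  failing with F , F≡ , _ , F⊆ ←
    subset-between {p = ∅} {q = ∁ ⁅ k ⁆} {k = 2 + i} ⊥⊆
      (≤-trans (≤-reflexive (∣⊥∣≡0 n)) z≤n)
      (≤-trans (s≤s i<l)
        (≤-reflexive (sym (trans (∣∁p∣≡n∸∣p∣ ⁅ k ⁆) (cong (n ∸_) (∣⁅x⁆∣≡1 k)))))) =
    F , F≡ , λ zf →
      x∈∁p⇒x∉p (F⊆ (isolated⇒initially-blue (Spine.B-isolated P refl) zf)) (x∈⁅x⁆ k)

module P₃ {n} (G : Graph n) (iso : G ≅ path 3) where

  open Forcing G

  private
    P = ≅path⇒spine iso

  open Spine P

  f∉middle : ∀ i → i ≢ 1F → f i ∉ ⁅ f 1F ⁆
  f∉middle i i≢1 fi∈ = i≢1 (f-inj (x∈⁅y⁆⇒x≡y (f 1F) fi∈))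

  end-forces : ZeroForcing G ⁅ f 0F ⁆
  end-forces = spine-end-forces P (λ ()) (x∈⁅x⁆ (f 0F))

  -- Both ends are white neighbours of the middle vertex, so it forces neither. The equation for `S`
  -- permits matching on `ε`, where `S` is `⊤`.
  middle-fails : ∀ {S} → S ≡ ⁅ f 1F ⁆ → ¬ ZeroForcing G S
  middle-fails eq ε = f∉middle 0F (λ ()) (subst (f 0F ∈_) eq ∈⊤)
  middle-fails refl ((u , v , (u∈ , _ , only) , _) ◅ _) with refl ← x∈⁅y⁆⇒x≡y (f 1F) u∈
    with () ← f-inj (trans
      (only (f 0F) (Equivalence.from (f-adj 1F 0F) (inj₂ refl) , f∉middle 0F λ ()))
      (sym (only (f 2F) (Equivalence.from (f-adj 1F 2F) (inj₁ refl) , f∉middle 2F λ ()))))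

  order≡3 : n ≡ 3
  order≡3 = ≅⇒order≡ iso

  mixed[1] : MixedCardinality G 1
  mixed[1] = (_ , ∣⁅x⁆∣≡1 (f 0F) , end-forces) , (_ , ∣⁅x⁆∣≡1 (f 1F) , middle-fails refl)

  -- Here 2 is n - 1, which cannot be mixed together with 1.
  unmixed[2] : ¬ MixedCardinality G 2
  unmixed[2] mixed = mixed[1]⇒unmixed[n-1] G (subst (2 ≤_) (sym order≡3) (s≤s (s≤s z≤n)))
    mixed[1] (subst (MixedCardinality G) (cong (_∸ 1) (sym order≡3)) mixed)

-- Graphs of span n - 1 and n - 2.

-- The order stays a variable below: on a numeral Agda would try to evaluate
-- the span by unfolding its decision procedures.
module _ {n} (G : Graph n) where

  open Counting G

  private
    λG = zeroForcingSpan G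

    n-1<n : 1 ≤ n → n ∸ 1 < n
    n-1<n = ∸-monoʳ-< z<s

  -- Span n - 1 makes every size strictly between 0 and n mixed; for n at least 2 this includes both
  -- 1 and n - 1.
  span≡n-1⇒K₁ : 1 ≤ n → λG + 1 ≡ n → G ≅ complete 1
  span≡n-1⇒K₁ 1≤n eq =
    [ (λ 1<n → ⊥-elim (mixed[1]⇒unmixed[n-1] G 1<n
        (span≡n-1⇒mixed eq z<s 1<n)
        (span≡n-1⇒mixed eq (m<n⇒0<n∸m 1<n) (n-1<n 1≤n))))
    , one-vertex⇒K₁ G ∘ sym ]′ (m≤n⇒m<n∨m≡n 1≤n)

  K₁⇒span≡n-1 : G ≅ complete 1 → λG + 1 ≡ n
  K₁⇒span≡n-1 iso = ≤-antisym
    -- No size lies strictly between 0 and 1, so the empty list gives the upper bound.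
    (subst (_≤ n) (trans (cong suc (+-identityʳ λG)) (+-comm 1 λG))
      (span-upper-interior (≤-reflexive (sym n≡1)) [] [] []))
    (≤-trans (≤-reflexive n≡1) (m≤n+m 1 λG))
    where
    n≡1 : n ≡ 1
    n≡1 = ≅⇒order≡ iso

  span≡n-2⇒path⊔K₁∨P₃ : ¬ (G ≅ complete 2) → λG + 2 ≡ n →
    (2 ≤ n × (G ≅ path (n ∸ 1) ⊔ᴳ complete 1)) ⊎ (G ≅ path 3)
  span≡n-2⇒path⊔K₁∨P₃ ≇K₂ eq =
    [ (λ 3≤n → by-mixed[1] 3≤n (mixedCardinality? G 1))
    , (λ 2≡n → inj₁ (2≤n , order2∧≇K₂⇒K₁⊔K₁ G 2≡n ≇K₂)) ]′ (m≤n⇒m<n∨m≡n 2≤n)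
    where
    2≤n : 2 ≤ n
    2≤n = ≤-trans (m≤n+m 2 λG) (≤-reflexive eq)

    1≤n : 1 ≤ n
    1≤n = <⇒≤ 2≤n

    0<n-1 : 0 < n ∸ 1
    0<n-1 = m<n⇒0<n∸m 2≤n

    n-2<n-1 : n ∸ 2 < n ∸ 1
    n-2<n-1 = ∸-monoʳ-< (s<s z<s) 2≤n

    by-mixed[1] : 3 ≤ n → Dec (MixedCardinality G 1) →
      (2 ≤ n × (G ≅ path (n ∸ 1) ⊔ᴳ complete 1)) ⊎ (G ≅ path 3)
    -- Span n - 2 permits a single unmixed interior size. Here it is 1, so 2 and n - 1 are mixed.
    by-mixed[1] 3≤n (no unmixed[1]) = inj₁ (2≤n , mixed[2]∧mixed[n-1]⇒path⊔K₁ G 1≤n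
      (span≡n-2⇒mixed eq z<s 2≤n z<s 3≤n (λ ()) unmixed[1])
      (span≡n-2⇒mixed eq z<s 2≤n 0<n-1 (n-1<n 1≤n) (<⇒≢ (∸-monoˡ-≤ 1 3≤n)) unmixed[1]))
    -- Here the unmixed interior size is n - 1, so n - 2 is mixed.
    by-mixed[1] 3≤n (yes mixed[1]) = inj₂ (mixed[1]∧mixed[n-2]⇒P₃ G 3≤n mixed[1]
      (span≡n-2⇒mixed eq 0<n-1 (n-1<n 1≤n) (m<n⇒0<n∸m 3≤n) (<-trans n-2<n-1 (n-1<n 1≤n))
        (≢-sym (<⇒≢ n-2<n-1)) (mixed[1]⇒unmixed[n-1] G 2≤n mixed[1])))

  interior-unmixed⇒span≤n-2 : ∀ {k} → 0 < k → k < n → ¬ MixedCardinality G k → λG + 2 ≤ n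
  interior-unmixed⇒span≤n-2 {k} 0<k k<n unmixed = subst (_≤ n) (sym (+-suc λG 1))
    (span-upper-interior (≤-<-trans z≤n k<n) (k ∷ []) ([] ∷ []) (((0<k , k<n) , unmixed) ∷ []))

  -- Size 1 is unmixed, which gives the upper bound; the sizes 2, ..., n - 1 are n - 2 mixed ones.
  path⊔K₁⇒span≡n-2 : 2 ≤ n → G ≅ path (n ∸ 1) ⊔ᴳ complete 1 → λG + 2 ≡ n
  path⊔K₁⇒span≡n-2 2≤n iso = ≤-antisym
    (interior-unmixed⇒span≤n-2 z<s 2≤n (path⊔K₁⇒unmixed[1] G 2≤n iso))
    (≤-trans (m≤n+m∸n n 2)
      (≤-trans (+-monoʳ-≤ 2 lower) (≤-reflexive (+-comm 2 λG))))
    where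
    lower : n ∸ 2 ≤ λG
    lower = subst (_≤ λG) (length-applyUpTo (2 +_) (n ∸ 2))
      (span-lower (applyUpTo (2 +_) (n ∸ 2))
        (applyUpTo⁺₁ (2 +_) (n ∸ 2) λ i<j _ → <⇒≢ i<j ∘ suc-injective ∘ suc-injective)
        (All-applyUpTo⁺ (2 +_) (n ∸ 2) (path⊔K₁⇒mixed G iso)))

  P₃⇒span≡n-2 : G ≅ path 3 → λG + 2 ≡ n
  P₃⇒span≡n-2 iso = ≤-antisym
    (interior-unmixed⇒span≤n-2 z<s (≤-reflexive (sym order≡3)) unmixed[2])
    (≤-trans (≤-reflexive order≡3) (+-monoˡ-≤ 2 (span-lower (1 ∷ []) ([] ∷ []) (mixed[1] ∷ []))))
    where open P₃ G iso

-- The graph `complete 2` is excluded because its span is 0, which is n - 2, though it has neither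
-- listed form. The guard `2 ≤ n` rules out order 1, where `path 0 ⊔ᴳ complete 1` is a single
-- vertex. Adding to the span avoids truncated subtraction.
theorem14 : ∀ (n : ℕ) → 1 ≤ n → (G : Graph n) →
    (zeroForcingSpan G + 1 ≡ n ⇔ G ≅ complete 1)
    × (¬ (G ≅ complete 2) →
    (zeroForcingSpan G + 2 ≡ n) ⇔
    ((2 ≤ n × (G ≅ path (n ∸ 1) ⊔ᴳ complete 1)) ⊎ (G ≅ path 3)))
theorem14 n 1≤n G =
  mk⇔ (span≡n-1⇒K₁ G 1≤n) (K₁⇒span≡n-1 G) ,
  λ ≇K₂ → mk⇔ (span≡n-2⇒path⊔K₁∨P₃ G ≇K₂)
    [ (λ (2≤n , iso) → path⊔K₁⇒span≡n-2 G 2≤n iso) , P₃⇒span≡n-2 G ]′
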